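{- A connected split graph is connected-domishold if and only if it is total domishold.
   Context: A graph is split if its vertex set can be partitioned into a clique and an independent set. A connected dominating set of a connected graph $G$ is a set $S\subseteq V(G)$ such that every vertex not in $S$ has a neighbor in $S$ and $G[S]$ is connected. A graph $G=(V,E)$ is connected-domishold if there exist $w:V\to\mathbb{R}_{\ge0}$ and $t\in\mathbb{R}_{\ge0}$ such that for all $S\subseteq V$, $\sum_{x\in S}w(x)\ge t$ iff $S$ is a connected dominating set. A total dominating set of $G$ is a set $S\subseteq V(G)$ such that every vertex of $G$ has a neighbor in $S$. $G$ is total domishold if there exist $w:V\to\mathbb{R}_{\ge0}$ and $t\in\mathbb{R}_{\ge0}$ such that for all $S\subseteq V$, $\sum_{x\in S}w(x)\ge t$ iff $S$ is a total dominating set of $G$. -}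

module Defs where

open import Level using (0ℓ)
open import Data.Bool using (if_then_else_)
open import Data.Fin using (Fin)
open import Data.Fin.Subset using (Subset; _∈_; _∉_; ∁)
open import Data.Nat as ℕ using (ℕ; _⊔_)
import Data.Nat.Properties as ℕₚ
open import Data.Product using (∃-syntax; Σ; _×_; _,_; proj₁; proj₂)
open import Data.Rational as ℚ using (ℚ; 0ℚ; ½; _-_; ∣_∣)
import Data.Rational.Properties as ℚₚ
open import Data.Rational.Solver using (module +-*-Solver)
open import Data.Vec using (lookup)
open import Data.Vec.Functional using (foldr)
open import Function.Bundles using (_⇔_)
open import Relation.Binary.Construct.Closure.ReflexiveTransitive using (Star)
open import Relation.Binary.Core using (Rel)
open import Relation.Binary.Definitions using (Decidable; Irreflexive; Symmetric)
open import Relation.Binary.PropositionalEquality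
open import Relation.Nullary using (¬_)

-- Real numbers are represented by Cauchy sequences of rationals, without
-- quotienting: two sequences x, y denote the same real iff x ≤ y and y ≤ x
-- for the order ≤ᵣ below.

IsCauchy : (ℕ → ℚ) → Set
IsCauchy x = ∀ ε → 0ℚ ℚ.< ε →
  ∃[ N ] (∀ m n → N ℕ.≤ m → N ℕ.≤ n → ∣ x m - x n ∣ ℚ.≤ ε)

record ℝ : Set where
  constructor mkℝ
  field
    seq    : ℕ → ℚ
    cauchy : IsCauchy seq

open ℝ public

private
  half-pos : ∀ {ε} → 0ℚ ℚ.< ε → 0ℚ ℚ.< ½ ℚ.* ε
  half-pos {ε} ε>0 =
    subst (ℚ._< ½ ℚ.* ε) (ℚₚ.*-zeroʳ ½) (ℚₚ.*-monoʳ-<-pos ½ ε>0)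

  half+half : ∀ ε → ½ ℚ.* ε ℚ.+ ½ ℚ.* ε ≡ ε
  half+half ε = trans (sym (ℚₚ.*-distribʳ-+ ε ½ ½)) (ℚₚ.*-identityˡ ε)

  regroup : ∀ a b c d → (a ℚ.+ b) - (c ℚ.+ d) ≡ (a - c) ℚ.+ (b - d)
  regroup = solve 4 (λ a b c d →
    (a :+ b) :+ (:- (c :+ d)) := (a :+ (:- c)) :+ (b :+ (:- d))) refl
    where open +-*-Solver

+-cauchy : ∀ x y → IsCauchy x → IsCauchy y → IsCauchy (λ n → x n ℚ.+ y n)
+-cauchy x y cx cy ε ε>0 = N₁ ⊔ N₂ , bound
  where
  N₁ = proj₁ (cx (½ ℚ.* ε) (half-pos ε>0))
  N₂ = proj₁ (cy (½ ℚ.* ε) (half-pos ε>0))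
  bound : ∀ m n → N₁ ⊔ N₂ ℕ.≤ m → N₁ ⊔ N₂ ℕ.≤ n →
          ∣ (x m ℚ.+ y m) - (x n ℚ.+ y n) ∣ ℚ.≤ ε
  bound m n N≤m N≤n = begin
    ∣ (x m ℚ.+ y m) - (x n ℚ.+ y n) ∣      ≡⟨ cong ∣_∣ (regroup (x m) (y m) (x n) (y n)) ⟩
    ∣ (x m - x n) ℚ.+ (y m - y n) ∣        ≤⟨ ℚₚ.∣p+q∣≤∣p∣+∣q∣ (x m - x n) (y m - y n) ⟩
    ∣ x m - x n ∣ ℚ.+ ∣ y m - y n ∣        ≤⟨ ℚₚ.+-mono-≤
      (proj₂ (cx _ (half-pos ε>0)) m n (ℕₚ.m⊔n≤o⇒m≤o N₁ N₂ N≤m) (ℕₚ.m⊔n≤o⇒m≤o N₁ N₂ N≤n))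
      (proj₂ (cy _ (half-pos ε>0)) m n (ℕₚ.m⊔n≤o⇒n≤o N₁ N₂ N≤m) (ℕₚ.m⊔n≤o⇒n≤o N₁ N₂ N≤n)) ⟩
    ½ ℚ.* ε ℚ.+ ½ ℚ.* ε                    ≡⟨ half+half ε ⟩
    ε                                      ∎
    where open ℚₚ.≤-Reasoning

infixl 6 _+ᵣ_
infix  4 _≤ᵣ_ _≥ᵣ_

_+ᵣ_ : ℝ → ℝ → ℝ
x +ᵣ y = mkℝ (λ n → seq x n ℚ.+ seq y n) (+-cauchy (seq x) (seq y) (cauchy x) (cauchy y))

0ᵣ : ℝ
0ᵣ = mkℝ (λ _ → 0ℚ) (λ ε ε>0 → 0 , λ _ _ _ _ → ℚₚ.<⇒≤ ε>0)

-- The order of the limits; a termwise (even eventual) comparison of the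
-- sequences would be too strong.
_≤ᵣ_ : Rel ℝ 0ℓ
x ≤ᵣ y = ∀ ε → 0ℚ ℚ.< ε → ∃[ N ] (∀ n → N ℕ.≤ n → seq x n ℚ.≤ seq y n ℚ.+ ε)

_≥ᵣ_ : Rel ℝ 0ℓ
x ≥ᵣ y = y ≤ᵣ x

-- Finite simple graphs with vertex set Fin n.
record Graph (n : ℕ) : Set₁ where
  field
    _~_      : Rel (Fin n) 0ℓ
    ~-sym    : Symmetric _~_
    ~-irrefl : Irreflexive _≡_ _~_
    _~?_     : Decidable _~_

-- The empty vertex set counts as connected; this can only matter for the
-- graph with no vertices, since otherwise the empty set is not dominating.
PathConnected : {A : Set} → Rel A 0ℓ → Set
PathConnected R = ∀ u v → Star R u v

module _ {n : ℕ} (G : Graph n) where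
  open Graph G

  Connected : Set
  Connected = PathConnected _~_

  IsClique : Subset n → Set
  IsClique K = ∀ u v → u ∈ K → v ∈ K → u ≢ v → u ~ v

  IsIndependent : Subset n → Set
  IsIndependent I = ∀ u v → u ∈ I → v ∈ I → ¬ (u ~ v)

  IsSplit : Set
  IsSplit = ∃[ K ] (IsClique K × IsIndependent (∁ K))

  -- Adjacency in the induced subgraph G[S].
  Induced : (S : Subset n) → Rel (Σ (Fin n) (_∈ S)) 0ℓ
  Induced S (u , _) (v , _) = u ~ v

  HasNeighbourIn : Fin n → Subset n → Set
  HasNeighbourIn v S = ∃[ u ] (u ∈ S × v ~ u)

  IsConnectedDominating : Subset n → Set
  IsConnectedDominating S =
    (∀ v → v ∉ S → HasNeighbourIn v S) × PathConnected (Induced S)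

  IsTotalDominating : Subset n → Set
  IsTotalDominating S = ∀ v → HasNeighbourIn v S

weight : ∀ {n} → (Fin n → ℝ) → Subset n → ℝ
weight w S = foldr _+ᵣ_ 0ᵣ (λ x → if lookup S x then w x else 0ᵣ)

LinearlySeparable : ∀ {n} → (Subset n → Set) → Set
LinearlySeparable {n} P =
  ∃[ w ] ∃[ t ] ((∀ (x : Fin n) → 0ᵣ ≤ᵣ w x) × 0ᵣ ≤ᵣ t ×
                 (∀ (S : Subset n) → weight w S ≥ᵣ t ⇔ P S))

ConnectedDomishold : ∀ {n} → Graph n → Set
ConnectedDomishold G = LinearlySeparable (IsConnectedDominating G)

TotalDomishold : ∀ {n} → Graph n → Set
TotalDomishold G = LinearlySeparable (IsTotalDominating G)

{-# OPTIONS --safe #-}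
module Submission where

-- In a split graph, a set without universal vertices is connected dominating iff
-- it is total dominating: a total dominating set is connected through its clique
-- vertices, and a connected dominating set with a vertex v and no universal vertex
-- must step out of v to reach a non-neighbour of v. A set with a universal vertex
-- is always connected dominating, and total dominating iff it has a second vertex.
-- So one passes from total to connected domination by raising the weights of the
-- universal vertices to the threshold, and back by perturbing the weights to be
-- positive and putting those of the universal vertices just below the threshold.

open import Defs
open import Data.Nat using (ℕ)
open import Function.Bundles using (_⇔_)

open import Level using (0ℓ)
open import Algebra.Bundles using (AbelianGroup)
open import Data.Bool using (true; false; if_then_else_)
open import Data.Fin using (Fin; zero; suc; punchIn; punchOut)
open import Data.Fin.Properties using (_≟_; all?; any?; ¬∀⟶∃¬; punchInᵢ≢i; punchIn-punchOut)
open import Data.Fin.Subset using (Subset; inside; outside; _∈_; _∉_; ⊥)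
open import Data.Fin.Subset.Properties using (_∈?_; ∉⊥; x∉p⇒x∈∁p)
open import Data.Nat as ℕ using (zero; suc; _⊔_)
import Data.Nat.Properties as ℕₚ
open import Data.Product using (∃-syntax; Σ; _×_; _,_; proj₁; proj₂)
open import Data.Rational as ℚ using (ℚ; 0ℚ; 1ℚ; ½; ∣_∣)
import Data.Rational.Properties as ℚₚ
open import Data.Rational.Solver using (module +-*-Solver)
open import Data.Sum using (inj₁; inj₂)
open import Data.Vec using ([]; _∷_; lookup)
open import Data.Vec.Functional using (Vector; replicate; removeAt)
open import Data.Vec.Properties using (lookup⇒[]=; []=⇒lookup)
open import Data.Vec.Properties.WithK using ([]=-irrelevant)
open import Function.Bundles using (mk⇔; module Equivalence)
open import Relation.Binary.Bundles using (Preorder)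
open import Relation.Binary.Core using (Rel)
open import Relation.Binary.Construct.Closure.ReflexiveTransitive using (Star; _◅_; _◅◅_)
  renaming (ε to stay)
open import Relation.Binary.PropositionalEquality
  using (_≡_; _≢_; refl; sym; trans; cong; cong₂; subst)
open import Relation.Nullary using (¬_; Dec; yes; no; contradiction; does)
open import Relation.Nullary.Decidable
  using (_×-dec_; _→-dec_; ¬?; decidable-stable; from-no; map′)
open import Relation.Unary using (Decidable)

-- Subset sums in totally ordered groups

-- The order is a preorder whose totality takes the form ≴⇒≳, which for the
-- reals, unlike x ≲ y ⊎ y ≲ x, is constructive. For the same reason gaps d are
-- only known to satisfy ¬ (d ≲ 0#), as 1# does.
record GroupOrder (G : AbelianGroup 0ℓ 0ℓ) : Set₁ where
  open AbelianGroup G using (Carrier; _≈_) renaming (_∙_ to _+_; ε to 0#)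
  infix  4 _≲_
  infixl 7 _⊓_
  field
    _≲_         : Rel Carrier 0ℓ
    _⊓_         : Carrier → Carrier → Carrier
    1#          : Carrier
    ≲-reflexive : ∀ {x y} → x ≈ y → x ≲ y
    ≲-trans     : ∀ {x y z} → x ≲ y → y ≲ z → x ≲ z
    ≴⇒≳         : ∀ {x y} → ¬ (x ≲ y) → y ≲ x
    +-mono      : ∀ {x y u v} → x ≲ y → u ≲ v → x + u ≲ y + v
    x⊓y≲x       : ∀ x y → x ⊓ y ≲ x
    x⊓y≲y       : ∀ x y → x ⊓ y ≲ y
    ⊓-glb       : ∀ {x y z} → z ≲ x → z ≲ y → z ≲ x ⊓ y
    1≴0         : ¬ (1# ≲ 0#)

module TotallyOrderedGroup {G : AbelianGroup 0ℓ 0ℓ} (O : GroupOrder G) where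

  open GroupOrder O
  open AbelianGroup G
    using (Carrier; _≈_; isEquivalence; identityˡ; identityʳ; assoc; _-_; group; commutativeMonoid)
    renaming (_∙_ to _+_; ε to 0#; _⁻¹ to -_; refl to ≈-refl; sym to ≈-sym;
              trans to ≈-trans; ∙-cong to +-cong; comm to +-comm)

  open import Algebra.Properties.Group group
    using (\\-leftDividesʳ; //-rightDividesˡ; //-rightDividesʳ)
  open import Algebra.Properties.CommutativeMonoid.Sum commutativeMonoid
    using (sum; sum-remove; ∑-distrib-+; sum-replicate; sum-replicate-zero; sum-cong-≋)
  open import Algebra.Properties.CommutativeMonoid.Mult commutativeMonoid
    using (×-distrib-+) renaming (_×_ to _·_)
  ≲-preorder : Preorder 0ℓ 0ℓ 0ℓ
  ≲-preorder = record
    { isPreorder = record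
      { isEquivalence = isEquivalence ; reflexive = ≲-reflexive ; trans = ≲-trans } }

  open import Relation.Binary.Reasoning.Preorder ≲-preorder

  -- Order arithmetic

  ≲-refl : ∀ {x} → x ≲ x
  ≲-refl = ≲-reflexive ≈-refl

  ≲-reflexive≡ : ∀ {x y} → x ≡ y → x ≲ y
  ≲-reflexive≡ refl = ≲-refl

  +-cancelˡ-≲ : ∀ x {y z} → x + y ≲ x + z → y ≲ z
  +-cancelˡ-≲ x {y} {z} x+y≲x+z = begin
    y                   ≈⟨ \\-leftDividesʳ x y ⟨
    - x + (x + y)       ≲⟨ +-mono (≲-refl { - x }) x+y≲x+z ⟩
    - x + (x + z)       ≈⟨ \\-leftDividesʳ x z ⟩
    z                   ∎

  x≲z-y⇒x+y≲z : ∀ {x y z} → x ≲ z - y → x + y ≲ z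
  x≲z-y⇒x+y≲z {x} {y} {z} p = ≲-trans (+-mono p ≲-refl) (≲-reflexive (//-rightDividesˡ y z))

  x+y≲z⇒x≲z-y : ∀ {x y z} → x + y ≲ z → x ≲ z - y
  x+y≲z⇒x≲z-y {x} {y} {z} p =
    ≲-trans (≲-reflexive (≈-sym (//-rightDividesʳ y x))) (+-mono p (≲-refl { - y }))

  x≲x+y : ∀ x {y} → 0# ≲ y → x ≲ x + y
  x≲x+y x 0≲y = ≲-trans (≲-reflexive (≈-sym (identityʳ x))) (+-mono ≲-refl 0≲y)

  x≲y+x : ∀ x {y} → 0# ≲ y → x ≲ y + x
  x≲y+x x 0≲y = ≲-trans (≲-reflexive (≈-sym (identityˡ x))) (+-mono 0≲y ≲-refl)

  ×-monoʳ : ∀ m {x y} → x ≲ y → m · x ≲ m · y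
  ×-monoʳ zero    x≲y = ≲-refl
  ×-monoʳ (suc m) x≲y = +-mono x≲y (×-monoʳ m x≲y)

  ×-nonneg : ∀ m {x} → 0# ≲ x → 0# ≲ m · x
  ×-nonneg zero    0≲x = ≲-refl
  ×-nonneg (suc m) 0≲x = ≲-trans 0≲x (x≲x+y _ (×-nonneg m 0≲x))

  -- The order cannot be decided, so there is no case split on the smaller argument. If `x ⊓ y ≲ z`,
  -- then `x ≲ y` is absurd, as it puts `x` below the minimum; so `≴⇒≳` gives `y ≲ x`, and then `y`
  -- is below the minimum.
  ⊓-≴ : ∀ {x y z} → ¬ (x ≲ z) → ¬ (y ≲ z) → ¬ (x ⊓ y ≲ z)
  ⊓-≴ {x} {y} {z} x≴z y≴z x⊓y≲z = y≴z (≲-trans (⊓-glb (≴⇒≳ x≴y) ≲-refl) x⊓y≲z)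
    where
    x≴y : ¬ (x ≲ y)
    x≴y x≲y = x≴z (≲-trans (⊓-glb ≲-refl x≲y) x⊓y≲z)

  -- Turns one gap per subset into a single gap for all of them.
  ⨅ : ∀ {n} → (Subset n → Carrier) → Carrier
  ⨅ {zero}  f = f []
  ⨅ {suc n} f = ⨅ (λ S → f (outside ∷ S)) ⊓ ⨅ (λ S → f (inside ∷ S))

  ⨅≲ : ∀ {n} (f : Subset n → Carrier) S → ⨅ f ≲ f S
  ⨅≲ f []            = ≲-refl
  ⨅≲ f (outside ∷ S) = ≲-trans (x⊓y≲x _ _) (⨅≲ (λ S → f (outside ∷ S)) S)
  ⨅≲ f (inside ∷ S)  =
    ≲-trans (x⊓y≲y (⨅ λ S → f (outside ∷ S)) _) (⨅≲ (λ S → f (inside ∷ S)) S)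

  ⨅-≴ : ∀ {n} (f : Subset n → Carrier) {x} → (∀ S → ¬ (f S ≲ x)) → ¬ (⨅ f ≲ x)
  ⨅-≴ {zero}  f f≴x = f≴x []
  ⨅-≴ {suc n} f f≴x = ⊓-≴ (⨅-≴ _ (λ S → f≴x (outside ∷ S))) (⨅-≴ _ (λ S → f≴x (inside ∷ S)))

  -- Finite sums

  sum-mono : ∀ {n} {f g : Vector Carrier n} → (∀ i → f i ≲ g i) → sum f ≲ sum g
  sum-mono {zero}  f≲g = ≲-refl
  sum-mono {suc n} f≲g = +-mono (f≲g zero) (sum-mono (λ i → f≲g (suc i)))

  sum-nonneg : ∀ {n} {f : Vector Carrier n} → (∀ i → 0# ≲ f i) → 0# ≲ sum f
  sum-nonneg {n} 0≲f = ≲-trans (≲-reflexive (≈-sym (sum-replicate-zero n))) (sum-mono 0≲f)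

  term≲sum : ∀ {n} (f : Vector Carrier n) → (∀ i → 0# ≲ f i) → ∀ i → f i ≲ sum f
  term≲sum {suc n} f 0≲f i =
    ≲-trans (x≲x+y (f i) (sum-nonneg (λ j → 0≲f (punchIn i j))))
            (≲-reflexive (≈-sym (sum-remove {i = i} f)))

  -- Once term `i` is taken out, term `j` survives at position `punchOut i≢j` of the rest.
  twoTerms≲sum : ∀ {n} (f : Vector Carrier n) → (∀ i → 0# ≲ f i) →
                 ∀ {i j} → i ≢ j → f i + f j ≲ sum f
  twoTerms≲sum {suc n} f 0≲f {i} {j} i≢j = begin
    f i + f j                            ≡⟨ cong (λ k → f i + f k) (punchIn-punchOut i≢j) ⟨
    f i + removeAt f i (punchOut i≢j)
      ≲⟨ +-mono ≲-refl (term≲sum (removeAt f i) (λ k → 0≲f (punchIn i k)) (punchOut i≢j)) ⟩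
    f i + sum (removeAt f i)             ≈⟨ sum-remove {i = i} f ⟨
    sum f                                ∎

  sum≲term : ∀ {n} (f : Vector Carrier n) i → (∀ j → i ≢ j → f j ≲ 0#) → sum f ≲ f i
  sum≲term {suc n} f i f≲0 = begin
    sum f                        ≈⟨ sum-remove {i = i} f ⟩
    f i + sum (removeAt f i)
      ≲⟨ +-mono ≲-refl (sum-mono λ j → f≲0 _ (λ eq → punchInᵢ≢i i j (sym eq))) ⟩
    f i + sum (replicate n 0#)   ≈⟨ +-cong ≈-refl (sum-replicate-zero n) ⟩
    f i + 0#                     ≈⟨ identityʳ (f i) ⟩
    f i                          ∎

  ×-distrib-sum : ∀ {n} m (f : Vector Carrier n) → m · sum f ≈ sum (λ i → m · f i)
  ×-distrib-sum {n} zero    f = ≈-sym (sum-replicate-zero n)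
  ×-distrib-sum (suc m) f =
    ≈-trans (+-cong ≈-refl (×-distrib-sum m f)) (≈-sym (∑-distrib-+ f (λ i → m · f i)))

  -- Weights of subsets

  restrict : ∀ {n} → (Fin n → Carrier) → Subset n → Fin n → Carrier
  restrict w S x = if lookup S x then w x else 0#

  -- Over the reals this unfolds to `weight`, and `Separable` to `LinearlySeparable`.
  subsetSum : ∀ {n} → (Fin n → Carrier) → Subset n → Carrier
  subsetSum w S = sum (restrict w S)

  module _ {n} (w : Fin n → Carrier) {S : Subset n} {x : Fin n} where

    restrict-∈ : x ∈ S → restrict w S x ≡ w x
    restrict-∈ x∈S rewrite []=⇒lookup x∈S = refl

    restrict-∉ : x ∉ S → restrict w S x ≡ 0#
    restrict-∉ x∉S with lookup S x in eq
    ... | true  = contradiction (lookup⇒[]= x S eq) x∉S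
    ... | false = refl

  module _ {n} {S : Subset n} where

    subsetSum-mono : ∀ {v w : Fin n → Carrier} → (∀ x → x ∈ S → v x ≲ w x) →
                     subsetSum v S ≲ subsetSum w S
    subsetSum-mono {v} {w} v≲w = sum-mono pointwise
      where
      pointwise : ∀ x → restrict v S x ≲ restrict w S x
      pointwise x with lookup S x in eq
      ... | true  = v≲w x (lookup⇒[]= x S eq)
      ... | false = ≲-refl

    restrict-nonneg : ∀ {w} → (∀ x → 0# ≲ w x) → ∀ x → 0# ≲ restrict w S x
    restrict-nonneg 0≲w x with lookup S x
    ... | true  = 0≲w x
    ... | false = ≲-refl

    subsetSum-nonneg : ∀ {w} → (∀ x → 0# ≲ w x) → 0# ≲ subsetSum w S
    subsetSum-nonneg 0≲w = sum-nonneg (restrict-nonneg 0≲w)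

    element≲subsetSum : ∀ w → (∀ x → 0# ≲ w x) → ∀ {x} → x ∈ S → w x ≲ subsetSum w S
    element≲subsetSum w 0≲w {x} x∈S = subst (_≲ subsetSum w S) (restrict-∈ w x∈S)
      (term≲sum (restrict w S) (restrict-nonneg 0≲w) x)

    pair≲subsetSum : ∀ w → (∀ x → 0# ≲ w x) →
                     ∀ {x y} → x ∈ S → y ∈ S → x ≢ y → w x + w y ≲ subsetSum w S
    pair≲subsetSum w 0≲w x∈S y∈S x≢y = subst (_≲ subsetSum w S)
      (cong₂ _+_ (restrict-∈ w x∈S) (restrict-∈ w y∈S))
      (twoTerms≲sum (restrict w S) (restrict-nonneg 0≲w) x≢y)

    subsetSum≲element : ∀ w {x} → x ∈ S → (∀ y → y ∈ S → x ≡ y) → subsetSum w S ≲ w x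
    subsetSum≲element w {x} x∈S only = subst (subsetSum w S ≲_) (restrict-∈ w x∈S)
      (sum≲term (restrict w S) x λ y x≢y →
        subst (_≲ 0#) (sym (restrict-∉ w (λ y∈S → x≢y (only y y∈S)))) ≲-refl)

    subsetSum-× : ∀ m w → m · subsetSum w S ≈ subsetSum (λ x → m · w x) S
    subsetSum-× m w = ≈-trans (×-distrib-sum m (restrict w S)) (sum-cong-≋ pointwise)
      where
      ×-zero : ∀ m → m · 0# ≈ 0#
      ×-zero zero    = ≈-refl
      ×-zero (suc m) = ≈-trans (identityˡ _) (×-zero m)
      pointwise : ∀ x → m · restrict w S x ≈ restrict (λ x → m · w x) S x
      pointwise x with lookup S x
      ... | true  = ≈-refl
      ... | false = ×-zero m

    -- Adding `d` at the vertices outside `S` too only increases the sum, and spares counting the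
    -- elements of `S`.
    subsetSum-+≲ : ∀ w {d} → 0# ≲ d → subsetSum (λ x → w x + d) S ≲ subsetSum w S + n · d
    subsetSum-+≲ w {d} 0≲d = begin
      subsetSum (λ x → w x + d) S           ≲⟨ sum-mono pointwise ⟩
      sum (λ x → restrict w S x + d)        ≈⟨ ∑-distrib-+ (restrict w S) (replicate n d) ⟩
      subsetSum w S + sum (replicate n d)   ≈⟨ +-cong ≈-refl (sum-replicate n) ⟩
      subsetSum w S + n · d                 ∎
      where
      pointwise : ∀ x → restrict (λ x → w x + d) S x ≲ restrict w S x + d
      pointwise x with lookup S x
      ... | true  = ≲-refl
      ... | false = x≲x+y 0# 0≲d

  -- Separability and gaps

  Separable : ∀ {n} → (Subset n → Set) → Set
  Separable {n} P = ∃[ w ] ∃[ t ] ((∀ (x : Fin n) → 0# ≲ w x) × 0# ≲ t ×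
                                   (∀ (S : Subset n) → t ≲ subsetSum w S ⇔ P S))

  -- Each subset outside `P` misses `t` by a gap of its own; there are finitely many subsets, so the
  -- minimum of the gaps works for all.
  separation-gap : ∀ {n} {P : Subset n → Set} → Decidable P →
    ∀ {w t} → (∀ S → t ≲ subsetSum w S ⇔ P S) →
    ∃[ d ] (¬ (d ≲ 0#) × (∀ S → ¬ P S → subsetSum w S + d ≲ t))
  separation-gap {n} {P} P? {w} {t} sep = ⨅ gap , ⨅-≴ gap gap≴0 , below
    where
    gap : Subset n → Carrier
    -- Subsets in `P` impose no bound; the default `1#` keeps them from spoiling the minimum.
    gap S = if does (P? S) then 1# else t - subsetSum w S
    gap≴0 : ∀ S → ¬ (gap S ≲ 0#)
    gap≴0 S with P? S
    ... | yes _  = 1≴0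
    ... | no ¬PS = λ gap≲0 → ¬PS (Equivalence.to (sep S) (begin
      t                                      ≈⟨ //-rightDividesˡ (subsetSum w S) t ⟨
      (t - subsetSum w S) + subsetSum w S    ≲⟨ +-mono gap≲0 ≲-refl ⟩
      0# + subsetSum w S                     ≈⟨ identityˡ _ ⟩
      subsetSum w S                          ∎))
    below : ∀ S → ¬ P S → subsetSum w S + ⨅ gap ≲ t
    below S ¬PS with P? S | ⨅≲ gap S
    ... | yes PS | _       = contradiction PS ¬PS
    ... | no _   | ⨅≲gap =
      ≲-trans (≲-reflexive (+-comm _ _)) (x≲z-y⇒x+y≲z ⨅≲gap)

  -- For a split graph, P and Q are the connected and the total dominating sets,
  -- and U the universal vertices.
  module _ {n} {P Q : Subset n → Set} {U : Fin n → Set}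
    (Q? : Decidable Q) (U? : Decidable U)
    (P-meets-U   : ∀ {S x} → x ∈ S → U x → P S)
    (P⇔Q-avoid-U : ∀ {S} → (∀ x → x ∈ S → ¬ U x) → P S ⇔ Q S)
    where

    private
      meets-U? : ∀ S → Dec (∃[ x ] (x ∈ S × U x))
      meets-U? S = any? λ x → (x ∈? S) ×-dec U? x

    -- One vertex of `U` reaches the threshold by its new weight `t`, and subsets avoiding `U` keep
    -- their weight.
    Q-separable⇒P-separable : Separable Q → Separable P
    Q-separable⇒P-separable (w , t , 0≲w , 0≲t , sep) = v , t , 0≲v , 0≲t , v-sep
      where
      v : Fin n → Carrier
      v x = if does (U? x) then t else w x
      0≲v : ∀ x → 0# ≲ v x
      0≲v x with U? x
      ... | yes _ = 0≲t
      ... | no _  = 0≲w x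
      t≲v : ∀ {x} → U x → t ≲ v x
      t≲v {x} Ux with U? x
      ... | yes _  = ≲-refl
      ... | no ¬Ux = contradiction Ux ¬Ux
      v≡w : ∀ {x} → ¬ U x → v x ≡ w x
      v≡w {x} ¬Ux with U? x
      ... | yes Ux = contradiction Ux ¬Ux
      ... | no _   = refl
      v-sep : ∀ S → t ≲ subsetSum v S ⇔ P S
      v-sep S with meets-U? S
      ... | yes (x , x∈S , Ux) = mk⇔
        (λ _ → P-meets-U x∈S Ux)
        (λ _ → ≲-trans (t≲v Ux) (element≲subsetSum v 0≲v x∈S))
      ... | no ¬meets = mk⇔
        (λ t≲vS → Equivalence.from P⇔Q (Equivalence.to (sep S)
          (≲-trans t≲vS (subsetSum-mono λ x x∈S → ≲-reflexive≡ (v≡w (avoid x x∈S))))))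
        (λ PS → ≲-trans (Equivalence.from (sep S) (Equivalence.to P⇔Q PS))
          (subsetSum-mono λ x x∈S → ≲-reflexive≡ (sym (v≡w (avoid x x∈S)))))
        where
        avoid : ∀ x → x ∈ S → ¬ U x
        avoid x x∈S Ux = ¬meets (x , x∈S , Ux)
        P⇔Q = P⇔Q-avoid-U avoid

    -- With a gap d below the threshold t of P and m = 2 + n, the weights m w + d
    -- off U still separate P at m t, because the added total n d stays below the
    -- scaled gap m d. As all of them are at least d, weight m t - d on U
    -- makes a vertex of U fall short of m t alone but reach it with any other.
    P-separable⇒Q-separable :
      (∀ {S x y} → x ∈ S → U x → y ∈ S → x ≢ y → Q S) →
      (∀ {S x} → x ∈ S → (∀ y → y ∈ S → x ≡ y) → ¬ Q S) →
      (Fin n → ¬ Q ⊥) →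
      Separable P → Separable Q
    P-separable⇒Q-separable Q-pair ¬Q-singleton ¬Q-∅ (w , t , 0≲w , 0≲t , sep) =
      v , m · t , 0≲v , ×-nonneg m 0≲t , v-sep
      where
      -- `P` holds on the subsets meeting `U` and agrees with `Q` on the others, so `Q?` suffices to
      -- decide it.
      P? : Decidable P
      P? S with meets-U? S
      ... | yes (x , x∈S , Ux) = yes (P-meets-U x∈S Ux)
      ... | no ¬meets = map′ (Equivalence.from P⇔Q) (Equivalence.to P⇔Q) (Q? S)
        where P⇔Q = P⇔Q-avoid-U λ x x∈S Ux → ¬meets (x , x∈S , Ux)

      m : ℕ
      m = suc (suc n)

      gap = separation-gap P? sep
      d = proj₁ gap
      d≴0 = proj₁ (proj₂ gap)
      below-gap = proj₂ (proj₂ gap)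

      0≲d : 0# ≲ d
      0≲d = ≴⇒≳ d≴0

      m·w : Fin n → Carrier
      m·w x = m · w x

      v : Fin n → Carrier
      v x = if does (U? x) then m · t - d else m·w x + d

      v-U : ∀ {x} → U x → v x ≡ m · t - d
      v-U {x} Ux with U? x
      ... | yes _  = refl
      ... | no ¬Ux = contradiction Ux ¬Ux

      v-¬U : ∀ {x} → ¬ U x → v x ≡ m·w x + d
      v-¬U {x} ¬Ux with U? x
      ... | yes Ux = contradiction Ux ¬Ux
      ... | no _   = refl

      -- The empty set avoids `U` and fails `Q`, hence fails `P`, so its weight stays `d` below `t`.
      -- The vertex argument excludes `n = 0`, where the empty set may satisfy `Q`.
      d≲t : Fin n → d ≲ t
      d≲t x = ≲-trans (x≲y+x d (subsetSum-nonneg {S = ⊥} 0≲w))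
        (below-gap ⊥ λ P∅ → ¬Q-∅ x
          (Equivalence.to (P⇔Q-avoid-U λ _ y∈⊥ → contradiction y∈⊥ ∉⊥) P∅))

      d≲v : ∀ x → d ≲ v x
      d≲v x with U? x
      ... | no _  = x≲y+x d (×-nonneg m (0≲w x))
      -- The first two summands `t` of `m · t` each cover one `d`.
      ... | yes _ = x+y≲z⇒x≲z-y (+-mono (d≲t x)
        (≲-trans (d≲t x) (x≲x+y t (×-nonneg n 0≲t))))

      0≲v : ∀ x → 0# ≲ v x
      0≲v x = ≲-trans 0≲d (d≲v x)

      v-sep : ∀ S → m · t ≲ subsetSum v S ⇔ Q S
      v-sep S with meets-U? S
      ... | no ¬meets = mk⇔
        (λ mt≲vS → Equivalence.to P⇔Q (decidable-stable (P? S) (light mt≲vS)))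
        (λ QS → heavy (Equivalence.from (sep S) (Equivalence.from P⇔Q QS)))
        where
        avoid : ∀ x → x ∈ S → ¬ U x
        avoid x x∈S Ux = ¬meets (x , x∈S , Ux)
        P⇔Q = P⇔Q-avoid-U avoid
        heavy : t ≲ subsetSum w S → m · t ≲ subsetSum v S
        heavy t≲wS = begin
          m · t                ≲⟨ ×-monoʳ m t≲wS ⟩
          m · subsetSum w S    ≈⟨ subsetSum-× {S = S} m w ⟩
          subsetSum m·w S      ≲⟨ subsetSum-mono (λ x x∈S →
            subst (m·w x ≲_) (sym (v-¬U (avoid x x∈S))) (x≲x+y (m·w x) 0≲d)) ⟩
          subsetSum v S        ∎
        -- If `P S` failed, the scaled gap `m · d` would fit into the perturbation `n · d`, leaving
        -- `d + d ≲ 0#`. The contradiction yields only a double negation, which `P?` removes.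
        light : m · t ≲ subsetSum v S → ¬ ¬ P S
        light mt≲vS ¬PS = d≴0 (≲-trans (x≲x+y d 0≲d) (+-cancelˡ-≲ (n · d) (begin
          n · d + (d + d)    ≈⟨ +-comm _ _ ⟩
          (d + d) + n · d    ≈⟨ assoc d d (n · d) ⟩
          m · d              ≲⟨ +-cancelˡ-≲ (m · subsetSum w S) scaled ⟩
          n · d              ≈⟨ identityʳ _ ⟨
          n · d + 0#         ∎)))
          where
          scaled : m · subsetSum w S + m · d ≲ m · subsetSum w S + n · d
          scaled = begin
            m · subsetSum w S + m · d          ≈⟨ ×-distrib-+ (subsetSum w S) d m ⟨
            m · (subsetSum w S + d)            ≲⟨ ×-monoʳ m (below-gap S ¬PS) ⟩
            m · t                              ≲⟨ mt≲vS ⟩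
            subsetSum v S                      ≲⟨ subsetSum-mono (λ x x∈S →
              ≲-reflexive≡ (v-¬U (avoid x x∈S))) ⟩
            subsetSum (λ x → m·w x + d) S      ≲⟨ subsetSum-+≲ {S = S} m·w 0≲d ⟩
            subsetSum m·w S + n · d            ≈⟨ +-cong (subsetSum-× {S = S} m w) ≈-refl ⟨
            m · subsetSum w S + n · d          ∎
      ... | yes (x , x∈S , Ux) with any? (λ y → (y ∈? S) ×-dec ¬? (x ≟ y))
      ...   | yes (y , y∈S , x≢y) = mk⇔
        (λ _ → Q-pair x∈S Ux y∈S x≢y)
        (λ _ → begin
          m · t              ≈⟨ //-rightDividesˡ d (m · t) ⟨
          (m · t - d) + d    ≡⟨ cong (_+ d) (v-U Ux) ⟨
          v x + d            ≲⟨ +-mono ≲-refl (d≲v y) ⟩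
          v x + v y          ≲⟨ pair≲subsetSum v 0≲v x∈S y∈S x≢y ⟩
          subsetSum v S      ∎)
      ...   | no ¬pair = mk⇔
        (λ mt≲vS → contradiction (+-cancelˡ-≲ (m · t) (begin
          m · t + d          ≲⟨ +-mono mt≲vS ≲-refl ⟩
          subsetSum v S + d  ≲⟨ +-mono (subsetSum≲element v x∈S only) ≲-refl ⟩
          v x + d            ≡⟨ cong (_+ d) (v-U Ux) ⟩
          (m · t - d) + d    ≈⟨ //-rightDividesˡ d (m · t) ⟩
          m · t              ≈⟨ identityʳ _ ⟨
          m · t + 0#         ∎)) d≴0)
        (λ QS → contradiction QS (¬Q-singleton x∈S only))
        where
        only : ∀ y → y ∈ S → x ≡ y
        only y y∈S = decidable-stable (x ≟ y) λ x≢y → ¬pair (y , y∈S , x≢y)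

-- Real numbers

open import Data.Rational using (_-_; _⊓_)

-- Rational inequalities

half-pos : ∀ {ε} → 0ℚ ℚ.< ε → 0ℚ ℚ.< ½ ℚ.* ε
half-pos {ε} ε>0 = subst (ℚ._< ½ ℚ.* ε) (ℚₚ.*-zeroʳ ½) (ℚₚ.*-monoʳ-<-pos ½ ε>0)

half+half : ∀ ε → ½ ℚ.* ε ℚ.+ ½ ℚ.* ε ≡ ε
half+half ε = trans (sym (ℚₚ.*-distribʳ-+ ε ½ ½)) (ℚₚ.*-identityˡ ε)

p≤∣p∣ : ∀ p → p ℚ.≤ ∣ p ∣
p≤∣p∣ p with ℚₚ.≤-total 0ℚ p
... | inj₁ 0≤p = ℚₚ.≤-reflexive (sym (ℚₚ.0≤p⇒∣p∣≡p 0≤p))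
... | inj₂ p≤0 = ℚₚ.≤-trans p≤0 (ℚₚ.0≤∣p∣ p)

p-q≤r⇒p≤q+r : ∀ {p q r} → p - q ℚ.≤ r → p ℚ.≤ q ℚ.+ r
p-q≤r⇒p≤q+r {p} {q} p-q≤r = subst (ℚ._≤ _)
  (solve 2 (λ p q → q :+ (p :+ (:- q)) := p) refl p q) (ℚₚ.+-monoʳ-≤ q p-q≤r)
  where open +-*-Solver

p≤q+r⇒p-q≤r : ∀ {p q r} → p ℚ.≤ q ℚ.+ r → p - q ℚ.≤ r
p≤q+r⇒p-q≤r {p} {q} {r} p≤q+r = subst (p - q ℚ.≤_)
  (solve 2 (λ q r → (q :+ r) :+ (:- q) := r) refl q r) (ℚₚ.+-monoˡ-≤ (ℚ.- q) p≤q+r)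
  where open +-*-Solver

∣p-q∣≤r : ∀ {p q r} → p ℚ.≤ q ℚ.+ r → q ℚ.≤ p ℚ.+ r → ∣ p - q ∣ ℚ.≤ r
∣p-q∣≤r {p} {q} {r} p≤q+r q≤p+r with ℚₚ.∣p∣≡p∨∣p∣≡-p (p - q)
... | inj₁ eq = subst (ℚ._≤ r) (sym eq) (p≤q+r⇒p-q≤r p≤q+r)
... | inj₂ eq = subst (ℚ._≤ r) (trans -[p-q]≡q-p (sym eq)) (p≤q+r⇒p-q≤r q≤p+r)
  where
  open +-*-Solver
  -[p-q]≡q-p = solve 2 (λ p q → q :+ (:- p) := :- (p :+ (:- q))) refl p q

-- One inequality suffices because m and n can be exchanged.
OneSidedCauchy : (ℕ → ℚ) → Set
OneSidedCauchy x = ∀ ε → 0ℚ ℚ.< ε →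
  ∃[ N ] (∀ m n → N ℕ.≤ m → N ℕ.≤ n → x m ℚ.≤ x n ℚ.+ ε)

oneSided⇒cauchy : ∀ x → OneSidedCauchy x → IsCauchy x
oneSided⇒cauchy x c ε ε>0 with N , bound ← c ε ε>0 =
  N , λ m n N≤m N≤n → ∣p-q∣≤r (bound m n N≤m N≤n) (bound n m N≤n N≤m)

oneSided : (x : ℝ) → OneSidedCauchy (seq x)
oneSided x ε ε>0 with N , bound ← cauchy x ε ε>0 =
  N , λ m n N≤m N≤n → p-q≤r⇒p≤q+r (ℚₚ.≤-trans (p≤∣p∣ _) (bound m n N≤m N≤n))

neg-≤-+ : ∀ {p q r} → q ℚ.≤ p ℚ.+ r → ℚ.- p ℚ.≤ ℚ.- q ℚ.+ r
neg-≤-+ {p} {q} {r} q≤p+r = begin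
  ℚ.- p                              ≡⟨ solve 2 (λ p q → :- p := q :+ (:- (p :+ q))) refl p q ⟩
  q ℚ.+ ℚ.- (p ℚ.+ q)                ≤⟨ ℚₚ.+-monoˡ-≤ (ℚ.- (p ℚ.+ q)) q≤p+r ⟩
  (p ℚ.+ r) ℚ.+ ℚ.- (p ℚ.+ q)
    ≡⟨ solve 3 (λ p q r → (p :+ r) :+ (:- (p :+ q)) := (:- q) :+ r) refl p q r ⟩
  ℚ.- q ℚ.+ r                        ∎
  where
  open ℚₚ.≤-Reasoning
  open +-*-Solver

-- Negation reverses the order, so the bound is used with `m` and `n` exchanged.
neg-oneSidedCauchy : ∀ x → OneSidedCauchy x → OneSidedCauchy (λ n → ℚ.- x n)
neg-oneSidedCauchy x c ε ε>0 = proj₁ (c ε ε>0) , λ m n N≤m N≤n →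
  neg-≤-+ {x m} {x n} {ε} (proj₂ (c ε ε>0) n m N≤n N≤m)

-- In the one-sided form it is enough that minima are monotone and commute with adding `ε`.
⊓-oneSidedCauchy : ∀ x y → OneSidedCauchy x → OneSidedCauchy y →
                   OneSidedCauchy (λ n → x n ⊓ y n)
⊓-oneSidedCauchy x y cx cy ε ε>0 = N₁ ⊔ N₂ , λ m n N≤m N≤n → begin
  x m ⊓ y m
    ≤⟨ ℚₚ.⊓-mono-≤
         (proj₂ (cx ε ε>0) m n (ℕₚ.m⊔n≤o⇒m≤o N₁ N₂ N≤m) (ℕₚ.m⊔n≤o⇒m≤o N₁ N₂ N≤n))
         (proj₂ (cy ε ε>0) m n (ℕₚ.m⊔n≤o⇒n≤o N₁ N₂ N≤m) (ℕₚ.m⊔n≤o⇒n≤o N₁ N₂ N≤n)) ⟩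
  (x n ℚ.+ ε) ⊓ (y n ℚ.+ ε)
    ≡⟨ ℚₚ.mono-≤-distrib-⊓ (ℚₚ.+-monoˡ-≤ ε) (x n) (y n) ⟨
  (x n ⊓ y n) ℚ.+ ε ∎
  where
  open ℚₚ.≤-Reasoning
  N₁ = proj₁ (cx ε ε>0)
  N₂ = proj₁ (cy ε ε>0)

-- Negation, minimum and unit of the reals

infix  8 -ᵣ_
infixl 7 _⊓ᵣ_

-ᵣ_ : ℝ → ℝ
-ᵣ x = mkℝ (λ n → ℚ.- seq x n)
  (oneSided⇒cauchy (λ n → ℚ.- seq x n) (neg-oneSidedCauchy (seq x) (oneSided x)))

_⊓ᵣ_ : ℝ → ℝ → ℝ
x ⊓ᵣ y = mkℝ (λ n → seq x n ⊓ seq y n)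
  (oneSided⇒cauchy (λ n → seq x n ⊓ seq y n)
    (⊓-oneSidedCauchy (seq x) (seq y) (oneSided x) (oneSided y)))

p≤p+q : ∀ p {q} → 0ℚ ℚ.≤ q → p ℚ.≤ p ℚ.+ q
p≤p+q p {q} 0≤q = subst (ℚ._≤ p ℚ.+ q) (ℚₚ.+-identityʳ p) (ℚₚ.+-monoʳ-≤ p 0≤q)

1ᵣ : ℝ
1ᵣ = mkℝ (λ _ → 1ℚ) (oneSided⇒cauchy (λ _ → 1ℚ) λ ε ε>0 →
  0 , λ _ _ _ _ → p≤p+q 1ℚ (ℚₚ.<⇒≤ ε>0))

-- Order laws of the reals

p+[q+q]≤r+q⇒p+q≤r : ∀ {p q r} → p ℚ.+ (q ℚ.+ q) ℚ.≤ r ℚ.+ q → p ℚ.+ q ℚ.≤ r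
p+[q+q]≤r+q⇒p+q≤r {p} {q} {r} p+2q≤r+q = begin
  p ℚ.+ q
    ≡⟨ solve 2 (λ p q → p :+ q := (p :+ (q :+ q)) :+ (:- q)) refl p q ⟩
  (p ℚ.+ (q ℚ.+ q)) ℚ.+ ℚ.- q
    ≤⟨ ℚₚ.+-monoˡ-≤ (ℚ.- q) p+2q≤r+q ⟩
  (r ℚ.+ q) ℚ.+ ℚ.- q
    ≡⟨ solve 2 (λ r q → (r :+ q) :+ (:- q) := r) refl r q ⟩
  r ∎
  where
  open ℚₚ.≤-Reasoning
  open +-*-Solver

-- A term beyond the Cauchy moduli for ε/4 either shows y ≤ x + ε from there on
-- or separates x from y.
≰ᵣ⇒≥ᵣ : ∀ x y → ¬ (x ≤ᵣ y) → y ≤ᵣ x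
≰ᵣ⇒≥ᵣ x y x≰y ε ε>0 = N , bound
  where
  open ℚₚ.≤-Reasoning
  open +-*-Solver
  ε/2 = ½ ℚ.* ε
  ε/4 = ½ ℚ.* ε/2
  xs = oneSided x ε/4 (half-pos (half-pos ε>0))
  ys = oneSided y ε/4 (half-pos (half-pos ε>0))
  N = proj₁ xs ⊔ proj₁ ys
  x-close : ∀ m n → N ℕ.≤ m → N ℕ.≤ n → seq x m ℚ.≤ seq x n ℚ.+ ε/4
  x-close m n N≤m N≤n =
    proj₂ xs m n (ℕₚ.m⊔n≤o⇒m≤o _ _ N≤m) (ℕₚ.m⊔n≤o⇒m≤o _ _ N≤n)
  y-close : ∀ m n → N ℕ.≤ m → N ℕ.≤ n → seq y m ℚ.≤ seq y n ℚ.+ ε/4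
  y-close m n N≤m N≤n =
    proj₂ ys m n (ℕₚ.m⊔n≤o⇒n≤o (proj₁ xs) _ N≤m) (ℕₚ.m⊔n≤o⇒n≤o (proj₁ xs) _ N≤n)
  -- From `N` on each sequence drifts by at most `ε/4`, so a gap of `ε/2` at `N` keeps `x` termwise
  -- below `y`, and the same `N` serves every `η`.
  separated : seq x N ℚ.+ ε/2 ℚ.≤ seq y N → x ≤ᵣ y
  separated gap η η>0 = N , λ n N≤n → begin
    seq x n            ≤⟨ x-close n N N≤n ℕₚ.≤-refl ⟩
    seq x N ℚ.+ ε/4    ≤⟨ p+[q+q]≤r+q⇒p+q≤r {seq x N} {ε/4} {seq y n} (begin
      seq x N ℚ.+ (ε/4 ℚ.+ ε/4)  ≡⟨ cong (seq x N ℚ.+_) (half+half ε/2) ⟩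
      seq x N ℚ.+ ε/2            ≤⟨ gap ⟩
      seq y N                    ≤⟨ y-close N n ℕₚ.≤-refl N≤n ⟩
      seq y n ℚ.+ ε/4            ∎) ⟩
    seq y n            ≤⟨ p≤p+q (seq y n) (ℚₚ.<⇒≤ η>0) ⟩
    seq y n ℚ.+ η      ∎
  unseparated : seq y N ℚ.≤ seq x N ℚ.+ ε/2
  unseparated = decidable-stable (seq y N ℚ.≤? seq x N ℚ.+ ε/2) λ y≰x+ε/2 →
    x≰y (separated (ℚₚ.<⇒≤ (ℚₚ.≰⇒> y≰x+ε/2)))
  bound : ∀ n → N ℕ.≤ n → seq y n ℚ.≤ seq x n ℚ.+ ε
  bound n N≤n = begin
    seq y n
      ≤⟨ y-close n N N≤n ℕₚ.≤-refl ⟩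
    seq y N ℚ.+ ε/4
      ≤⟨ ℚₚ.+-monoˡ-≤ ε/4 unseparated ⟩
    (seq x N ℚ.+ ε/2) ℚ.+ ε/4
      ≤⟨ ℚₚ.+-monoˡ-≤ ε/4 (ℚₚ.+-monoˡ-≤ ε/2 (x-close N n ℕₚ.≤-refl N≤n)) ⟩
    ((seq x n ℚ.+ ε/4) ℚ.+ ε/2) ℚ.+ ε/4
      ≡⟨ solve 3 (λ a d e → ((a :+ d) :+ e) :+ d := a :+ ((d :+ d) :+ e)) refl
           (seq x n) ε/4 ε/2 ⟩
    seq x n ℚ.+ ((ε/4 ℚ.+ ε/4) ℚ.+ ε/2)
      ≡⟨ cong (λ e → seq x n ℚ.+ (e ℚ.+ ε/2)) (half+half ε/2) ⟩
    seq x n ℚ.+ (ε/2 ℚ.+ ε/2)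
      ≡⟨ cong (seq x n ℚ.+_) (half+half ε) ⟩
    seq x n ℚ.+ ε ∎

termwise-≤ : ∀ x y → (∀ k → seq x k ℚ.≤ seq y k) → x ≤ᵣ y
termwise-≤ x y x≤y ε ε>0 =
  0 , λ k _ → ℚₚ.≤-trans (x≤y k) (p≤p+q (seq y k) (ℚₚ.<⇒≤ ε>0))

≤ᵣ-trans : ∀ x y z → x ≤ᵣ y → y ≤ᵣ z → x ≤ᵣ z
≤ᵣ-trans x y z x≤y y≤z ε ε>0 = N₁ ⊔ N₂ , λ n N≤n → begin
  seq x n                            ≤⟨ proj₂ (x≤y ε/2 ε/2>0) n (ℕₚ.m⊔n≤o⇒m≤o N₁ N₂ N≤n) ⟩
  seq y n ℚ.+ ε/2
    ≤⟨ ℚₚ.+-monoˡ-≤ ε/2 (proj₂ (y≤z ε/2 ε/2>0) n (ℕₚ.m⊔n≤o⇒n≤o N₁ N₂ N≤n)) ⟩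
  (seq z n ℚ.+ ε/2) ℚ.+ ε/2          ≡⟨ ℚₚ.+-assoc (seq z n) ε/2 ε/2 ⟩
  seq z n ℚ.+ (ε/2 ℚ.+ ε/2)          ≡⟨ cong (seq z n ℚ.+_) (half+half ε) ⟩
  seq z n ℚ.+ ε                      ∎
  where
  open ℚₚ.≤-Reasoning
  ε/2 = ½ ℚ.* ε
  ε/2>0 = half-pos ε>0
  N₁ = proj₁ (x≤y ε/2 ε/2>0)
  N₂ = proj₁ (y≤z ε/2 ε/2>0)

+ᵣ-mono : ∀ x y u v → x ≤ᵣ y → u ≤ᵣ v → (x +ᵣ u) ≤ᵣ (y +ᵣ v)
+ᵣ-mono x y u v x≤y u≤v ε ε>0 = N₁ ⊔ N₂ , λ n N≤n → begin
  seq x n ℚ.+ seq u n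
    ≤⟨ ℚₚ.+-mono-≤ (proj₂ (x≤y ε/2 ε/2>0) n (ℕₚ.m⊔n≤o⇒m≤o N₁ N₂ N≤n))
                   (proj₂ (u≤v ε/2 ε/2>0) n (ℕₚ.m⊔n≤o⇒n≤o N₁ N₂ N≤n)) ⟩
  (seq y n ℚ.+ ε/2) ℚ.+ (seq v n ℚ.+ ε/2)
    ≡⟨ solve 3 (λ a b e → (a :+ e) :+ (b :+ e) := (a :+ b) :+ (e :+ e)) refl
         (seq y n) (seq v n) ε/2 ⟩
  (seq y n ℚ.+ seq v n) ℚ.+ (ε/2 ℚ.+ ε/2)
    ≡⟨ cong (seq y n ℚ.+ seq v n ℚ.+_) (half+half ε) ⟩
  (seq y n ℚ.+ seq v n) ℚ.+ ε ∎
  where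
  open ℚₚ.≤-Reasoning
  open +-*-Solver
  ε/2 = ½ ℚ.* ε
  ε/2>0 = half-pos ε>0
  N₁ = proj₁ (x≤y ε/2 ε/2>0)
  N₂ = proj₁ (u≤v ε/2 ε/2>0)

⊓ᵣ-glb : ∀ x y z → z ≤ᵣ x → z ≤ᵣ y → z ≤ᵣ (x ⊓ᵣ y)
⊓ᵣ-glb x y z z≤x z≤y ε ε>0 = N₁ ⊔ N₂ , λ n N≤n → begin
  seq z n
    ≤⟨ ℚₚ.⊓-glb (proj₂ (z≤x ε ε>0) n (ℕₚ.m⊔n≤o⇒m≤o N₁ N₂ N≤n))
                (proj₂ (z≤y ε ε>0) n (ℕₚ.m⊔n≤o⇒n≤o N₁ N₂ N≤n)) ⟩
  (seq x n ℚ.+ ε) ⊓ (seq y n ℚ.+ ε)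
    ≡⟨ ℚₚ.mono-≤-distrib-⊓ (ℚₚ.+-monoˡ-≤ ε) (seq x n) (seq y n) ⟨
  (seq x n ⊓ seq y n) ℚ.+ ε ∎
  where
  open ℚₚ.≤-Reasoning
  N₁ = proj₁ (z≤x ε ε>0)
  N₂ = proj₁ (z≤y ε ε>0)

1≰0 : ¬ (1ᵣ ≤ᵣ 0ᵣ)
1≰0 1≤0 = contradiction (proj₂ bound (proj₁ bound) ℕₚ.≤-refl) (from-no (1ℚ ℚ.≤? 0ℚ ℚ.+ ½))
  where bound = 1≤0 ½ (ℚₚ.positive⁻¹ ½)

-- Termwise equality is finer than equality of reals, but all the algebraic laws
-- hold termwise.
ℝ-group : AbelianGroup 0ℓ 0ℓ
ℝ-group = record
  { Carrier = ℝ
  ; _≈_ = λ x y → ∀ k → seq x k ≡ seq y k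
  ; _∙_ = _+ᵣ_
  ; ε = 0ᵣ
  ; _⁻¹ = -ᵣ_
  ; isAbelianGroup = record
    { isGroup = record
      { isMonoid = record
        { isSemigroup = record
          { isMagma = record
            { isEquivalence = record
              { refl = λ _ → refl
              ; sym = λ p k → sym (p k)
              ; trans = λ p q k → trans (p k) (q k)
              }
            ; ∙-cong = λ p q k → cong₂ ℚ._+_ (p k) (q k)
            }
          ; assoc = λ x y z k → ℚₚ.+-assoc (seq x k) (seq y k) (seq z k)
          }
        ; identity = (λ x k → ℚₚ.+-identityˡ (seq x k)) , (λ x k → ℚₚ.+-identityʳ (seq x k))
        }
      ; inverse = (λ x k → ℚₚ.+-inverseˡ (seq x k)) , (λ x k → ℚₚ.+-inverseʳ (seq x k))
      ; ⁻¹-cong = λ p k → cong ℚ.-_ (p k)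
      }
    ; comm = λ x y k → ℚₚ.+-comm (seq x k) (seq y k)
    }
  }

ℝ-order : GroupOrder ℝ-group
ℝ-order = record
  { _≲_ = _≤ᵣ_
  ; _⊓_ = _⊓ᵣ_
  ; 1# = 1ᵣ
  ; ≲-reflexive = λ {x} {y} x≈y → termwise-≤ x y λ k → ℚₚ.≤-reflexive (x≈y k)
  ; ≲-trans = λ {x} {y} {z} → ≤ᵣ-trans x y z
  ; ≴⇒≳ = λ {x} {y} → ≰ᵣ⇒≥ᵣ x y
  ; +-mono = λ {x} {y} {u} {v} → +ᵣ-mono x y u v
  ; x⊓y≲x = λ x y → termwise-≤ (x ⊓ᵣ y) x λ k → ℚₚ.p⊓q≤p (seq x k) (seq y k)
  ; x⊓y≲y = λ x y → termwise-≤ (x ⊓ᵣ y) y λ k → ℚₚ.p⊓q≤q (seq x k) (seq y k)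
  ; ⊓-glb = λ {x} {y} {z} → ⊓ᵣ-glb x y z
  ; 1≴0 = 1≰0
  }

-- Split graphs

module _ {n} (G : Graph n) where
  open Graph G

  IsUniversal : Fin n → Set
  IsUniversal u = ∀ v → u ≢ v → u ~ v

  isUniversal? : Decidable IsUniversal
  isUniversal? u = all? λ v → ¬? (u ≟ v) →-dec (u ~? v)

  -- Adjacency is decidable on a finite vertex set, so a counterexample can be found by search.
  ¬universal⇒nonNeighbour : ∀ {u} → ¬ IsUniversal u → ∃[ v ] (u ≢ v × ¬ (u ~ v))
  ¬universal⇒nonNeighbour {u} ¬univ
    with v , ¬u≢v→u~v ← ¬∀⟶∃¬ n _ (λ v → ¬? (u ≟ v) →-dec (u ~? v)) ¬univ =
    v , (λ u≡v → ¬u≢v→u~v (λ u≢v → contradiction u≡v u≢v)) , (λ u~v → ¬u≢v→u~v (λ _ → u~v))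

  isTotalDominating? : Decidable (IsTotalDominating G)
  isTotalDominating? S = all? λ v → any? λ u → (u ∈? S) ×-dec (v ~? u)

  -- Total versus connected domination

  module _ {S : Subset n} where

    -- Vertices of the induced subgraph carry a membership proof; such proofs are unique, so the
    -- empty walk suffices.
    same : ∀ {u} (p q : u ∈ S) → Star (Induced G S) (u , p) (u , q)
    same p q rewrite []=-irrelevant p q = stay

    -- A walk to a different vertex is nonempty, and its first edge ends in `S`.
    firstStep : ∀ {u v} {p : u ∈ S} {q : v ∈ S} → u ≢ v →
                Star (Induced G S) (u , p) (v , q) → HasNeighbourIn G u S
    firstStep u≢v stay                      = contradiction refl u≢v
    firstStep u≢v (_◅_ {j = x , x∈S} u~x _) = x , x∈S , u~x

    universal∈⇒connectedDominating : ∀ {u} → u ∈ S → IsUniversal u → IsConnectedDominating G S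
    universal∈⇒connectedDominating {u} u∈S univ = dominating , connected
      where
      dominating : ∀ v → v ∉ S → HasNeighbourIn G v S
      dominating v v∉S = u , u∈S , ~-sym (univ v λ { refl → v∉S u∈S })
      fromU : ∀ {v} (q : v ∈ S) → Star (Induced G S) (u , u∈S) (v , q)
      fromU {v} q with u ≟ v
      ... | yes refl = same u∈S q
      ... | no u≢v   = univ v u≢v ◅ stay
      toU : ∀ {v} (q : v ∈ S) → Star (Induced G S) (v , q) (u , u∈S)
      toU {v} q with u ≟ v
      ... | yes refl = same q u∈S
      ... | no u≢v   = ~-sym (univ v u≢v) ◅ stay
      connected : PathConnected (Induced G S)
      connected (_ , p) (_ , q) = toU p ◅◅ fromU q

    -- `u` is a neighbour of every vertex but itself, and `v` is a neighbour of `u`.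
    universal∈⇒totalDominating : ∀ {u v} → u ∈ S → IsUniversal u → v ∈ S → u ≢ v →
                                 IsTotalDominating G S
    universal∈⇒totalDominating {u} {v} u∈S univ v∈S u≢v x with u ≟ x
    ... | yes refl = v , v∈S , univ v u≢v
    ... | no u≢x   = u , u∈S , ~-sym (univ x u≢x)

    singleton-¬totalDominating : ∀ {u} → u ∈ S → (∀ v → v ∈ S → u ≡ v) → ¬ IsTotalDominating G S
    singleton-¬totalDominating {u} _ only td with v , v∈S , u~v ← td u =
      ~-irrefl (only v v∈S) u~v

    -- Only `v ∈ S` needs an argument. Let `x` be a non-neighbour of `v`. Either `x` lies in `S`, or
    -- some `y ∈ S` dominates it, and `y` is not `v` because `v` is not adjacent to `x`. The walk in
    -- `S` from `v` to that vertex starts at a neighbour of `v`.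
    connectedDominating⇒totalDominating : (∀ x → x ∈ S → ¬ IsUniversal x) →
      IsConnectedDominating G S → IsTotalDominating G S
    connectedDominating⇒totalDominating avoid (dominating , connected) v with v ∈? S
    ... | no v∉S  = dominating v v∉S
    ... | yes v∈S with x , v≢x , v≁x ← ¬universal⇒nonNeighbour (avoid v v∈S) | x ∈? S
    ...   | yes x∈S = firstStep v≢x (connected (v , v∈S) (x , x∈S))
    ...   | no x∉S with y , y∈S , x~y ← dominating x x∉S =
      firstStep (λ { refl → v≁x (~-sym x~y) }) (connected (v , v∈S) (y , y∈S))

    -- A vertex of `S` outside `K` has a neighbour in `S`, which lies in `K` by independence. So
    -- every vertex of `S` is in `K` or adjacent to a vertex of both `S` and `K`, and `K` is a
    -- clique.
    totalDominating⇒connectedDominating : IsSplit G →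
      IsTotalDominating G S → IsConnectedDominating G S
    totalDominating⇒connectedDominating (K , clique , independent) td = (λ v _ → td v) , connected
      where
      -- The walk to `k` is for the start of a connection, the walk back for its end.
      cliqueVertex : ∀ {u} (p : u ∈ S) → ∃[ k ] Σ (k ∈ S) λ q → k ∈ K ×
        Star (Induced G S) (u , p) (k , q) × Star (Induced G S) (k , q) (u , p)
      cliqueVertex {u} p with u ∈? K
      ... | yes u∈K = u , p , u∈K , stay , stay
      ... | no u∉K with k , q , u~k ← td u =
        k , q , k∈K , u~k ◅ stay , ~-sym u~k ◅ stay
        where
        k∈K : k ∈ K
        k∈K = decidable-stable (k ∈? K) λ k∉K →
          independent u k (x∉p⇒x∈∁p u∉K) (x∉p⇒x∈∁p k∉K) u~k
      connected : PathConnected (Induced G S)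
      connected (u , p) (v , q)
        with k , k∈S , k∈K , u⟶k , _ ← cliqueVertex p
           | l , l∈S , l∈K , _ , l⟶v ← cliqueVertex q = u⟶k ◅◅ (k⟶l ◅◅ l⟶v)
        where
        k⟶l : Star (Induced G S) (k , k∈S) (l , l∈S)
        k⟶l with k ≟ l
        ... | yes refl = same k∈S l∈S
        ... | no k≢l   = clique k l k∈K l∈K k≢l ◅ stay

mainTheorem5 : ∀ (n : ℕ) (G : Graph n) → Connected G → IsSplit G →
    ConnectedDomishold G ⇔ TotalDomishold G
mainTheorem5 n G _ split = mk⇔
  (P-separable⇒Q-separable td? univ? cd-meets cd⇔td
    (universal∈⇒totalDominating G) (singleton-¬totalDominating G)
    -- A total dominating set contains a neighbour of `x`, so it is not empty.
    (λ x td → ∉⊥ (proj₁ (proj₂ (td x)))))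
  (Q-separable⇒P-separable td? univ? cd-meets cd⇔td)
  where
  open TotallyOrderedGroup ℝ-order
  td? = isTotalDominating? G
  univ? = isUniversal? G
  cd-meets : ∀ {S x} → x ∈ S → IsUniversal G x → IsConnectedDominating G S
  cd-meets = universal∈⇒connectedDominating G
  cd⇔td : ∀ {S} → (∀ x → x ∈ S → ¬ IsUniversal G x) →
          IsConnectedDominating G S ⇔ IsTotalDominating G S
  cd⇔td avoid = mk⇔ (connectedDominating⇒totalDominating G avoid)
                    (totalDominating⇒connectedDominating G split)
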